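{- Let $\mathcal{U}$ be an idempotent ultrafilter in $(\beta\mathbb{N},\oplus)$, let $k\in\mathbb{N}$ and let $n_{1},n_{2},\dots,n_{k+1}$ be natural numbers with $n_{i}\neq n_{i+1}$ for every index $i\leq k$. Then for every set $$A\in n_{1}\mathcal{U}\oplus n_{2}\mathcal{U}\oplus\cdots\oplus n_{k+1}\mathcal{U}$$ there exist $x_{1},\dots,x_{k},y_{1},\dots,y_{k},z_{1},\dots,z_{k}\in A$ such that the following three conditions hold: (1) for every $i\leq k$, $x_{i}<y_{i}$ and $x_{i}<z_{i}$; (2) for every $i\leq k$, $n_{i}(z_{i}-x_{i})=n_{i+1}(y_{i}-x_{i})$; (3) for every $i\leq k-1$, $x_{i+1}=z_{i}$.
   Context: Here $\mathbb{N}=\{1,2,3,\dots\}$, and $\beta\mathbb{N}$ is the set of ultrafilters on $\mathbb{N}$. The operation $\oplus$ is the extension of addition to $\beta\mathbb{N}$ given, for $\mathcal{U},\mathcal{V}\in\beta\mathbb{N}$ and $A\subseteq\mathbb{N}$, by $$A\in\mathcal{U}\oplus\mathcal{V}\iff\{n\in\mathbb{N}\mid\{m\in\mathbb{N}\mid n+m\in A\}\in\mathcal{V}\}\in\mathcal{U};$$ it is associative. An ultrafilter $\mathcal{U}$ is idempotent if $\mathcal{U}\oplus\mathcal{U}=\mathcal{U}$. For $n\in\mathbb{N}$, $n\mathcal{U}$ denotes the ultrafilter $\{A\subseteq\mathbb{N}\mid\{m\in\mathbb{N}\mid nm\in A\}\in\mathcal{U}\}$. -}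

module Defs where

open import Data.Fin.Base using (Fin)
open import Data.Nat.Base as ℕ using (ℕ; suc; NonZero)
open import Data.Nat.Properties using (m*n≢0)
open import Data.Product.Base using (_,_)
open import Data.Sum.Base using (_⊎_; inj₁; inj₂)
open import Data.Vec.Base using (foldr₁; tabulate)
open import Level using (0ℓ)
open import Relation.Unary
  using (Pred; _∈_; _∉_; _⊆_; _≐_; _∩_; _⊢_; ∁; U; Satisfiable)

-- The proof of positivity is irrelevant, so two elements with equal values are
-- equal.
record ℕ⁺ : Set where
  constructor mkℕ⁺
  field
    val            : ℕ
    .{{positive}} : NonZero val

open ℕ⁺ public using (val)

infixl 6 _+⁺_
infixl 7 _*⁺_

m+n≢0 : ∀ m n .{{_ : NonZero m}} → NonZero (m ℕ.+ n)
m+n≢0 (suc _) _ = _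

_+⁺_ : ℕ⁺ → ℕ⁺ → ℕ⁺
mkℕ⁺ m +⁺ mkℕ⁺ n = mkℕ⁺ (m ℕ.+ n) {{m+n≢0 m n}}

_*⁺_ : ℕ⁺ → ℕ⁺ → ℕ⁺
mkℕ⁺ m *⁺ mkℕ⁺ n = mkℕ⁺ (m ℕ.* n) {{m*n≢0 m n}}

-- Families of sets are 0ℓ-valued, so that { n ∣ { m ∣ n + m ∈ A } ∈ 𝓥 } is
-- again a subset of ℕ⁺ at the same level.
Family : Set₁
Family = Pred (Pred ℕ⁺ 0ℓ) 0ℓ

-- Properness is stated positively (every member has an element).  Classically
-- this is ∅ ∉ 𝓕; constructively, with `ultra`, it amounts to ∅ ∉ 𝓕 together
-- with excluded middle for Set.
record IsUltrafilter (𝓕 : Family) : Set₁ where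
  field
    whole    : U ∈ 𝓕
    upward   : ∀ {A B} → A ⊆ B → A ∈ 𝓕 → B ∈ 𝓕
    meet     : ∀ {A B} → A ∈ 𝓕 → B ∈ 𝓕 → A ∩ B ∈ 𝓕
    nonempty : ∀ {A} → A ∈ 𝓕 → Satisfiable A
    ultra    : ∀ A → A ∈ 𝓕 ⊎ ∁ A ∈ 𝓕

record βℕ : Set₁ where
  field
    sets          : Family
    isUltrafilter : IsUltrafilter sets

  open IsUltrafilter isUltrafilter public

open βℕ public using (sets)

infix  4 _≈_
infixr 6 _⊕_
infixr 7 _·_

-- Equality of ultrafilters: they have the same members.
_≈_ : βℕ → βℕ → Set₁
𝓤 ≈ 𝓥 = sets 𝓤 ≐ sets 𝓥

_⊕_ : βℕ → βℕ → βℕ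
𝓤 ⊕ 𝓥 = record
  { sets          = λ A → (λ n → (λ m → n +⁺ m ∈ A) ∈ sets 𝓥) ∈ sets 𝓤
  ; isUltrafilter = record
    { whole    = 𝓤.upward (λ _ → 𝓥.whole) 𝓤.whole
    ; upward   = λ A⊆B → 𝓤.upward (𝓥.upward A⊆B)
    ; meet     = λ p q → 𝓤.upward (λ (a , b) → 𝓥.meet a b) (𝓤.meet p q)
    ; nonempty = λ p → let n , q = 𝓤.nonempty p
                           m , r = 𝓥.nonempty q
                       in n +⁺ m , r
    ; ultra    = ultra
    }
  }
  where
  module 𝓤 = βℕ 𝓤
  module 𝓥 = βℕ 𝓥

  complement : ∀ {A} → A ∉ 𝓥.sets → ∁ A ∈ 𝓥.sets
  complement {A} A∉ with 𝓥.ultra A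
  ... | inj₁ A∈  with () ← A∉ A∈
  ... | inj₂ ∁A∈ = ∁A∈

  ultra : ∀ A → (λ n → (λ m → n +⁺ m ∈ A) ∈ 𝓥.sets) ∈ 𝓤.sets
              ⊎ (λ n → (λ m → n +⁺ m ∈ ∁ A) ∈ 𝓥.sets) ∈ 𝓤.sets
  ultra A with 𝓤.ultra (λ n → (λ m → n +⁺ m ∈ A) ∈ 𝓥.sets)
  ... | inj₁ p = inj₁ p
  ... | inj₂ p = inj₂ (𝓤.upward complement p)

_·_ : ℕ⁺ → βℕ → βℕ
n · 𝓤 = record
  { sets          = λ A → (λ m → n *⁺ m ∈ A) ∈ sets 𝓤
  ; isUltrafilter = record
    { whole    = 𝓤.whole
    ; upward   = λ A⊆B → 𝓤.upward A⊆B
    ; meet     = 𝓤.meet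
    ; nonempty = λ p → let m , q = 𝓤.nonempty p in n *⁺ m , q
    ; ultra    = λ A → 𝓤.ultra ((n *⁺_) ⊢ A)
    }
  }
  where module 𝓤 = βℕ 𝓤

Idempotent : βℕ → Set₁
Idempotent 𝓤 = 𝓤 ⊕ 𝓤 ≈ 𝓤

-- 𝓤₁ ⊕ (𝓤₂ ⊕ ⋯ ); the bracketing is immaterial, as ⊕ is associative.
⨁ : ∀ {k} → (Fin (suc k) → βℕ) → βℕ
⨁ 𝓤 = foldr₁ _⊕_ (tabulate 𝓤)

{-# OPTIONS --safe #-}

-- For 𝓤-generic a₁, …, aₖ₊₁ the sum n₁a₁ + ⋯ + nₖ₊₁aₖ₊₁ lies in A.  As 𝓤 is
-- idempotent, nᵢ𝓤 can be doubled to nᵢ𝓤 ⊕ nᵢ𝓤, so one may also choose a generic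
-- bᵢ between aᵢ and aᵢ₊₁ and add it to either of them.  Hence xᵢ,
-- yᵢ = xᵢ + nᵢbᵢ and zᵢ = xᵢ + nᵢ₊₁bᵢ all lie in A, where xᵢ₊₁ = zᵢ, and
-- nᵢ (zᵢ − xᵢ) = nᵢnᵢ₊₁bᵢ = nᵢ₊₁ (yᵢ − xᵢ).
module Submission where

open import Defs
open import Data.Fin.Base using (Fin; zero; suc; inject₁; toℕ)
open import Data.Fin.Properties using (toℕ-inject₁; toℕ-injective)
open import Data.Nat.Base using (ℕ; zero; suc; NonZero; _*_; _∸_; _<_; >-nonZero⁻¹)
open import Data.Nat.Properties
  using (+-assoc; *-distribˡ-+; m+n∸m≡n; m<m+n)
open import Data.Nat.Solver using (module +-*-Solver)
open import Data.Product.Base using (Σ-syntax; _×_; _,_; proj₁; proj₂)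
open import Function.Base using (_∘_)
open import Level using (0ℓ)
open import Relation.Binary.PropositionalEquality.Core
  using (_≡_; _≢_; refl; sym; trans; cong; subst)
open import Relation.Binary.PropositionalEquality.Properties
  using (module ≡-Reasoning)
open import Relation.Unary using (Pred; _∈_; _⊢_)

open +-*-Solver using (solve; _:+_; _:*_; _:=_)

val-injective : ∀ {a b} → val a ≡ val b → a ≡ b
val-injective refl = refl

+⁺-assoc : ∀ a b c → (a +⁺ b) +⁺ c ≡ a +⁺ (b +⁺ c)
+⁺-assoc a b c = val-injective (+-assoc (val a) (val b) (val c))

*⁺-distribˡ-+⁺ : ∀ n a b → n *⁺ (a +⁺ b) ≡ n *⁺ a +⁺ n *⁺ b
*⁺-distribˡ-+⁺ n a b = val-injective (*-distribˡ-+ (val n) (val a) (val b))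

+⁺-shift : ∀ a b c → a +⁺ (b +⁺ c) ≡ (a +⁺ c) +⁺ b
+⁺-shift a b c = val-injective
  (solve 3 (λ a b c → a :+ (b :+ c) := (a :+ c) :+ b) refl (val a) (val b) (val c))

+⁺-assoc₃ : ∀ a b c d → a +⁺ (b +⁺ (c +⁺ d)) ≡ (a +⁺ (b +⁺ c)) +⁺ d
+⁺-assoc₃ a b c d = trans (cong (a +⁺_) (sym (+⁺-assoc b c d)))
                          (sym (+⁺-assoc a (b +⁺ c) d))

x<x+⁺d : ∀ x d → val x < val (x +⁺ d)
x<x+⁺d x (mkℕ⁺ d) = m<m+n (val x) (>-nonZero⁻¹ d)

scaled-difference-swap : ∀ x d m n →
  val m * (val (x +⁺ n *⁺ d) ∸ val x) ≡ val n * (val (x +⁺ m *⁺ d) ∸ val x)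
scaled-difference-swap x d m n = begin
  val m * (val (x +⁺ n *⁺ d) ∸ val x)  ≡⟨ cong (val m *_) (m+n∸m≡n (val x) _) ⟩
  val m * (val n * val d)              ≡⟨ swap (val m) (val n) (val d) ⟩
  val n * (val m * val d)              ≡⟨ cong (val n *_) (m+n∸m≡n (val x) _) ⟨
  val n * (val (x +⁺ m *⁺ d) ∸ val x)  ∎
  where
  open ≡-Reasoning
  swap : ∀ a b c → a * (b * c) ≡ b * (a * c)
  swap = solve 3 (λ a b c → a :* (b :* c) := b :* (a :* c)) refl

⨁-scaled : βℕ → ∀ {k} → (Fin (suc k) → ℕ⁺) → βℕ
⨁-scaled 𝓤 n = ⨁ (λ i → n i · 𝓤)

module _ (𝓤 : βℕ) (idem : Idempotent 𝓤) where

  private module 𝓤 = βℕ 𝓤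

  -- Multiplication by `n` distributes over `+⁺`, so `n · 𝓤` inherits from `𝓤` the inclusion of `𝓤`
  -- in `𝓤 ⊕ 𝓤`.
  ·-absorbs : ∀ n A → A ∈ sets (n · 𝓤) → A ∈ sets (n · 𝓤 ⊕ n · 𝓤)
  ·-absorbs n A A∈ =
    𝓤.upward (λ {a} → 𝓤.upward (λ {b} → subst A (*⁺-distribˡ-+⁺ n a b)))
             (proj₂ idem {(n *⁺_) ⊢ A} A∈)

  -- Doubling is applied to the set of those `a` for which `𝓦`-most `m` satisfy `a +⁺ m ∈ A`;
  -- associativity then regroups the sum.
  ·-⊕-absorbs : ∀ n 𝓦 A →
    A ∈ sets (n · 𝓤 ⊕ 𝓦) → A ∈ sets (n · 𝓤 ⊕ n · 𝓤 ⊕ 𝓦)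
  ·-⊕-absorbs n 𝓦 A A∈ =
    𝓤.upward (λ {a} → 𝓤.upward (λ {b} → 𝓦.upward (λ {m} →
               subst A (+⁺-assoc (n *⁺ a) (n *⁺ b) m))))
             (·-absorbs n (λ a → (λ m → a +⁺ m ∈ A) ∈ 𝓦.sets) A∈)
    where module 𝓦 = βℕ 𝓦

  ⨁-absorbs : ∀ k (n : Fin (suc k) → ℕ⁺) A →
    A ∈ sets (⨁-scaled 𝓤 n) → A ∈ sets (n zero · 𝓤 ⊕ ⨁-scaled 𝓤 n)
  ⨁-absorbs zero    n = ·-absorbs (n zero)
  ⨁-absorbs (suc k) n = ·-⊕-absorbs (n zero) (⨁-scaled 𝓤 (n ∘ suc))

  -- The points are x₁, …, xₖ, zₖ, and the i-th gap is bᵢ.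
  record Chain {k} (n : Fin (suc k) → ℕ⁺) (A : Pred ℕ⁺ 0ℓ) : Set where
    field
      point  : Fin (suc k) → ℕ⁺
      gap    : Fin k → ℕ⁺
      point∈ : ∀ i → point i ∈ A
      side∈  : ∀ i → point (inject₁ i) +⁺ n (inject₁ i) *⁺ gap i ∈ A
      step   : ∀ i → point (suc i) ≡ point (inject₁ i) +⁺ n (suc i) *⁺ gap i

  -- Induction on `k` with `A` arbitrary, since the tail is applied to an intersection of three
  -- shifts of `A`.
  chain : ∀ k (n : Fin (suc k) → ℕ⁺) A → A ∈ sets (⨁-scaled 𝓤 n) → Chain n A
  chain zero n A A∈ = record
    { point  = λ _ → n zero *⁺ proj₁ (𝓤.nonempty A∈)
    ; gap    = λ ()
    ; point∈ = λ { zero → proj₂ (𝓤.nonempty A∈) }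
    ; side∈  = λ ()
    ; step   = λ ()
    }
  chain (suc k) n A A∈
    -- Doubling the first summand makes room for a later `b` scaled by `n zero`, while the same `a`
    -- still works without it.
    with a , A∈₀ , A∈ₗ ← 𝓤.nonempty (𝓤.meet A∈ (⨁-absorbs (suc k) n A A∈))
    -- Doubling the second summand lets the same `b` be scaled by `n (suc zero)` instead.
    with b , A∈₁ , A∈₂ ← 𝓤.nonempty (𝓤.meet A∈ₗ
           (⨁-absorbs k (n ∘ suc) (λ m → n zero *⁺ a +⁺ m ∈ A) A∈₀))
    -- Only the first point of the tail is used without `right`. Every later point is a tail point
    -- moved by `base` and `right`, so the tail's first point becomes the end of the new first gap.
    = record
    { point  = λ { zero    → base +⁺ C.point zero
                 ; (suc i) → base +⁺ (right +⁺ C.point i) }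
    ; gap    = λ { zero → b ; (suc i) → C.gap i }
    ; point∈ = λ { zero    → proj₁ (C.point∈ zero)
                 ; (suc i) → proj₂ (proj₂ (C.point∈ i)) }
    ; side∈  = λ { zero    → subst A (+⁺-shift base left (C.point zero))
                                     (proj₁ (proj₂ (C.point∈ zero)))
                 ; (suc i) → subst A (+⁺-assoc₃ base right (C.point (inject₁ i)) (n (suc (inject₁ i)) *⁺ C.gap i))
                                     (proj₂ (proj₂ (C.side∈ i))) }
    ; step   = λ { zero    → +⁺-shift base right (C.point zero)
                 ; (suc i) → trans (cong (λ p → base +⁺ (right +⁺ p)) (C.step i))
                                   (+⁺-assoc₃ base right (C.point (inject₁ i)) (n (suc (suc i)) *⁺ C.gap i)) }
    }
    where
    base  = n zero *⁺ a
    left  = n zero *⁺ b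
    right = n (suc zero) *⁺ b
    module 𝓥 = βℕ (⨁-scaled 𝓤 (n ∘ suc))
    -- A tail point m thus has base + m, base + left + m and base + right + m all in `A`; for the
    -- first one these are x₁, y₁ and z₁.
    module C = Chain (chain k (n ∘ suc) _ (𝓥.meet A∈₀ (𝓥.meet A∈₁ A∈₂)))

theorem3p4 :
    (𝓤 : βℕ) → Idempotent 𝓤 →
    (k : ℕ) .{{_ : NonZero k}} (n : Fin (suc k) → ℕ⁺) →
    (∀ (i : Fin k) → n (inject₁ i) ≢ n (suc i)) →
    (A : Pred ℕ⁺ 0ℓ) → A ∈ sets (⨁ (λ i → n i · 𝓤)) →
    Σ[ x ∈ (Fin k → ℕ⁺) ] Σ[ y ∈ (Fin k → ℕ⁺) ] Σ[ z ∈ (Fin k → ℕ⁺) ]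
      (∀ i → x i ∈ A × y i ∈ A × z i ∈ A)
      × (∀ i → val (x i) < val (y i) × val (x i) < val (z i))
      × (∀ i → val (n (inject₁ i)) * (val (z i) ∸ val (x i)) ≡ val (n (suc i)) * (val (y i) ∸ val (x i)))
      × (∀ i j → toℕ j ≡ suc (toℕ i) → x j ≡ z i)
theorem3p4 𝓤 idem k n _ A A∈ =
    x , y , point ∘ suc
  , (λ i → point∈ (inject₁ i) , side∈ i , point∈ (suc i))
  , (λ i → x<x+⁺d (x i) (n (inject₁ i) *⁺ gap i)
         , subst (λ z → val (x i) < val z) (sym (step i)) (x<x+⁺d (x i) (n (suc i) *⁺ gap i)))
  , (λ i → subst (λ z → val (n (inject₁ i)) * (val z ∸ val (x i))
                        ≡ val (n (suc i)) * (val (y i) ∸ val (x i)))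
                 (sym (step i))
                 (scaled-difference-swap (x i) (gap i) (n (inject₁ i)) (n (suc i))))
  -- Both sides are values of `point`, at `inject₁ j` and `suc i`, which are the same index.
  , (λ i j j≡1+i → cong point (toℕ-injective (trans (toℕ-inject₁ j) j≡1+i)))
  where
  open Chain (chain 𝓤 idem k n A A∈)
  x y : Fin k → ℕ⁺
  x i = point (inject₁ i)
  y i = x i +⁺ n (inject₁ i) *⁺ gap i
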